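{- Let $C_{(\leq,>)}(x,y)$ be the bivariate generating function of the Catalan words avoiding the ordered pair of relations $(\leq,>)$, where $x$ marks the length and $y$ marks the number of descents. Then $$C_{(\leq,>)}(x,y)=\frac {1-x}{1-2x}.$$
   Context: A Catalan word of length $n$ is a word $w=w_1w_2\cdots w_n$ over the non-negative integers with $w_1=0$ and $0\leq w_i\leq w_{i-1}+1$ for $i=2,\dots,n$; the empty word is the unique Catalan word of length $0$. For relations $X,Y\in\{<,>,\leq,\geq,=,\neq\}$, a word $w$ contains the pattern $(X,Y)$ if there is an index $i\geq 1$ (with $i+2\le n$) such that $w_i\,X\,w_{i+1}$ and $w_{i+1}\,Y\,w_{i+2}$; otherwise $w$ avoids $(X,Y)$. The number of descents $\mathrm{des}(w)$ is the number of indices $i$ with $w_i>w_{i+1}$. The bivariate generating function is $C_{(X,Y)}(x,y)=\sum_{w}x^{|w|}y^{\mathrm{des}(w)}$, the sum being over all Catalan words $w$ (of any length $|w|\geq 0$) avoiding $(X,Y)$. Identities are between formal power series in $x$ with coefficients polynomials in $y$. -}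

module Defs where

open import Data.Bool.Base using (if_then_else_)
open import Data.Integer.Base as ℤ using (ℤ; 0ℤ; 1ℤ; +_)
import Data.Integer.Properties as ℤₚ
open import Data.List.Base
  using (List; []; _∷_; length; map; foldr; filter; head; upTo; applyUpTo; cartesianProductWith)
open import Data.List.Membership.Propositional using (_∈_)
open import Data.List.Membership.Propositional.Properties
  using (∈-cartesianProductWith⁺; ∈-cartesianProductWith⁻; ∈-filter⁺; ∈-filter⁻; ∈-upTo⁺)
open import Data.List.Properties using (∷-injective)
open import Data.List.Relation.Unary.All using (All; []; _∷_)
open import Data.List.Relation.Unary.Any using (here)
open import Data.List.Relation.Unary.Linked using (Linked; []; [-]; _∷_; linked?)
open import Data.List.Relation.Unary.Unique.Propositional using (Unique; []; _∷_)
import Data.List.Relation.Unary.Unique.Propositional.Properties as Uniqueₚ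
import Data.Maybe.Relation.Unary.All as Maybe
open import Data.Nat.Base using (ℕ; zero; suc; _+_; _∸_; _≤_; _<_; z<s)
open import Data.Nat.Properties using (_≟_; _≤?_; _>?_; ≤-trans; ≤-reflexive; +-suc; +-monoˡ-≤; m<m+n)
open import Data.Product.Base using (_×_; _,_)
open import Data.Sum.Base using (inj₁; inj₂)
open import Function.Bundles using (_⇔_; mk⇔)
open import Level using (0ℓ)
open import Relation.Binary.Core using (Rel)
open import Relation.Binary.Definitions using (Decidable)
open import Relation.Binary.PropositionalEquality
  using (_≡_; refl; sym; trans; cong; module ≡-Reasoning)
open import Relation.Nullary.Decidable
  using (no; does; map′; _×-dec_; _⊎-dec_; ¬?)
open import Relation.Nullary.Negation using (¬_)
import Relation.Unary as U

Word : Set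
Word = List ℕ

Catalan : Word → Set
Catalan w = Maybe.All (_≡ 0) (head w) × Linked (λ a b → b ≤ suc a) w

catalan? : U.Decidable Catalan
catalan? w = Maybe.dec (_≟ 0) (head w) ×-dec linked? (λ a b → b ≤? suc a) w

data Contains (X Y : Rel ℕ 0ℓ) : Word → Set where
  here  : ∀ {a b c w} → X a b → Y b c → Contains X Y (a ∷ b ∷ c ∷ w)
  there : ∀ {a w} → Contains X Y w → Contains X Y (a ∷ w)

Avoids : (X Y : Rel ℕ 0ℓ) → Word → Set
Avoids X Y w = ¬ Contains X Y w

contains? : ∀ {X Y} → Decidable X → Decidable Y → U.Decidable (Contains X Y)
contains? X? Y? []               = no λ ()
contains? X? Y? (a ∷ [])         = no λ { (there ()) }
contains? X? Y? (a ∷ b ∷ [])     = no λ { (there (there ())) }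
contains? X? Y? (a ∷ b ∷ c ∷ w)  =
  map′ (λ { (inj₁ (p , q)) → here p q ; (inj₂ r) → there r })
       (λ { (here p q) → inj₁ (p , q) ; (there r) → inj₂ r })
       ((X? a b ×-dec Y? b c) ⊎-dec contains? X? Y? (b ∷ c ∷ w))

avoids? : ∀ {X Y} → Decidable X → Decidable Y → U.Decidable (Avoids X Y)
avoids? X? Y? w = ¬? (contains? X? Y? w)

des : Word → ℕ
des (a ∷ b ∷ w) = (if does (a >? b) then 1 else 0) + des (b ∷ w)
des _           = 0

words : (m n : ℕ) → List Word
words m zero    = [] ∷ []
words m (suc n) = cartesianProductWith _∷_ (upTo m) (words m n)

-- The letters of a Catalan word of length n are smaller than n, so every such
-- word is listed, and exactly once: see ∈-catalanWords and catalanWords-unique.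
catalanWords : ℕ → List Word
catalanWords n = filter catalan? (words n n)

-- Coefficient lists, constant term first. Trailing zeros are allowed, so
-- equality of polynomials is _≈ᵖ_ rather than _≡_.
Poly : Set
Poly = List ℤ

coeff : Poly → ℕ → ℤ
coeff []      _       = 0ℤ
coeff (a ∷ p) zero    = a
coeff (a ∷ p) (suc k) = coeff p k

infix 4 _≈ᵖ_
_≈ᵖ_ : Poly → Poly → Set
p ≈ᵖ q = ∀ k → coeff p k ≡ coeff q k

0ᵖ 1ᵖ : Poly
0ᵖ = []
1ᵖ = 1ℤ ∷ []

infixl 6 _+ᵖ_ _-ᵖ_
infixl 7 _*ᵖ_ _·ᵖ_
infix  8 y^_

_+ᵖ_ : Poly → Poly → Poly
[]      +ᵖ q       = q
(a ∷ p) +ᵖ []      = a ∷ p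
(a ∷ p) +ᵖ (b ∷ q) = (a ℤ.+ b) ∷ (p +ᵖ q)

_-ᵖ_ : Poly → Poly → Poly
p -ᵖ q = p +ᵖ map ℤ.-_ q

_·ᵖ_ : ℤ → Poly → Poly
a ·ᵖ p = map (a ℤ.*_) p

_*ᵖ_ : Poly → Poly → Poly
[]      *ᵖ q = []
(a ∷ p) *ᵖ q = a ·ᵖ q +ᵖ (0ℤ ∷ p *ᵖ q)

y^_ : ℕ → Poly
y^ zero  = 1ᵖ
y^ suc k = 0ℤ ∷ y^ k

sumᵖ : List Poly → Poly
sumᵖ = foldr _+ᵖ_ 0ᵖ

Series : Set
Series = ℕ → Poly

infix 4 _≈ˢ_
_≈ˢ_ : Series → Series → Set
F ≈ˢ G = ∀ n → F n ≈ᵖ G n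

const : Poly → Series
const p zero    = p
const p (suc _) = 0ᵖ

1ˢ 2ˢ x : Series
1ˢ = const 1ᵖ
2ˢ = const (+ 2 ∷ [])
x 1       = 1ᵖ
x _       = 0ᵖ

infixl 6 _-ˢ_
infixl 7 _*ˢ_ _/ˢ_

_-ˢ_ : Series → Series → Series
(F -ˢ G) n = F n -ᵖ G n

_*ˢ_ : Series → Series → Series
(F *ˢ G) n = sumᵖ (applyUpTo (λ i → F i *ᵖ G (n ∸ i)) (suc n))

record UnitConst (G : Series) : Set where
  constructor unitConst
  field const≈1 : G 0 ≈ᵖ 1ᵖ

-- Long division in increasing powers of x: for G 0 = 1,
-- F / G = F 0 + x (F′ - F 0 · G′) / G with F′, G′ the series shifted down by
-- one power of x. /ˢ-correct shows that this is the quotient.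
_/ˢ_ : (F G : Series) .{{_ : UnitConst G}} → Series
(F /ˢ G) zero    = F 0
(F /ˢ G) (suc n) = ((λ k → F (suc k) -ᵖ F 0 *ᵖ G (suc k)) /ˢ G) n

instance
  1-2x-unitConst : UnitConst (1ˢ -ˢ 2ˢ *ˢ x)
  1-2x-unitConst = unitConst λ { zero → refl ; (suc zero) → refl ; (suc (suc _)) → refl }

C : ∀ {X Y : Rel ℕ 0ℓ} → Decidable X → Decidable Y → Series
C X? Y? n = sumᵖ (map (λ w → y^ des w) (filter (avoids? X? Y?) (catalanWords n)))

words-length : ∀ m n {w} → w ∈ words m n → length w ≡ n
words-length m zero    (here refl) = refl
words-length m (suc n) w∈
  with _ , _ , _ , v∈ , refl ← ∈-cartesianProductWith⁻ _∷_ (upTo m) (words m n) w∈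
  = cong suc (words-length m n v∈)

∈-words : ∀ {m w} → All (_< m) w → w ∈ words m (length w)
∈-words []       = here refl
∈-words (p ∷ ps) = ∈-cartesianProductWith⁺ _∷_ (∈-upTo⁺ p) (∈-words ps)

words-unique : ∀ m n → Unique (words m n)
words-unique m zero    = [] ∷ []
words-unique m (suc n) =
  Uniqueₚ.cartesianProductWith⁺ _∷_ ∷-injective (Uniqueₚ.upTo⁺ m) (words-unique m n)

linked-bound : ∀ {a w} → Linked (λ a b → b ≤ suc a) (a ∷ w) →
               ∀ {m} → a + length (a ∷ w) ≤ m → All (_< m) (a ∷ w)
linked-bound {a} [-]     le = ≤-trans (m<m+n a z<s) le ∷ []
linked-bound {a} (_∷_ {xs = xs} r l) le =
  ≤-trans (m<m+n a z<s) le ∷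
  linked-bound l (≤-trans (+-monoˡ-≤ _ r)
    (≤-trans (≤-reflexive (sym (+-suc a (suc (length xs))))) le))

catalan-bound : ∀ {w} → Catalan w → All (_< length w) w
catalan-bound {[]}    _                     = []
catalan-bound {_ ∷ _} (Maybe.just refl , l) = linked-bound l (≤-reflexive refl)

∈-catalanWords : ∀ {n w} → w ∈ catalanWords n ⇔ (Catalan w × length w ≡ n)
∈-catalanWords {n} = mk⇔
  (λ w∈ → let v∈ , c = ∈-filter⁻ catalan? {xs = words n n} w∈ in c , words-length n n v∈)
  (λ { (c , refl) → ∈-filter⁺ catalan? (∈-words (catalan-bound c)) c })

catalanWords-unique : ∀ n → Unique (catalanWords n)
catalanWords-unique n = Uniqueₚ.filter⁺ catalan? (words-unique n n)

coeff-+ : ∀ p q k → coeff (p +ᵖ q) k ≡ coeff p k ℤ.+ coeff q k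
coeff-+ []      q       k       = sym (ℤₚ.+-identityˡ _)
coeff-+ (a ∷ p) []      k       = sym (ℤₚ.+-identityʳ _)
coeff-+ (a ∷ p) (b ∷ q) zero    = refl
coeff-+ (a ∷ p) (b ∷ q) (suc k) = coeff-+ p q k

coeff-neg : ∀ p k → coeff (map ℤ.-_ p) k ≡ ℤ.- coeff p k
coeff-neg []      k       = refl
coeff-neg (a ∷ p) zero    = refl
coeff-neg (a ∷ p) (suc k) = coeff-neg p k

coeff-· : ∀ a p k → coeff (a ·ᵖ p) k ≡ a ℤ.* coeff p k
coeff-· a []      k       = sym (ℤₚ.*-zeroʳ a)
coeff-· a (b ∷ p) zero    = refl
coeff-· a (b ∷ p) (suc k) = coeff-· a p k

*ᵖ-identityʳ : ∀ p {q} → q ≈ᵖ 1ᵖ → p *ᵖ q ≈ᵖ p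
*ᵖ-identityʳ []      q≈1 k = refl
*ᵖ-identityʳ (a ∷ p) {q} q≈1 zero
  rewrite coeff-+ (a ·ᵖ q) (0ℤ ∷ p *ᵖ q) 0 | coeff-· a q 0 | q≈1 0 =
  trans (ℤₚ.+-identityʳ _) (ℤₚ.*-identityʳ a)
*ᵖ-identityʳ (a ∷ p) {q} q≈1 (suc k)
  rewrite coeff-+ (a ·ᵖ q) (0ℤ ∷ p *ᵖ q) (suc k) | coeff-· a q (suc k) | q≈1 (suc k)
        | ℤₚ.*-zeroʳ a =
  trans (ℤₚ.+-identityˡ _) (*ᵖ-identityʳ p q≈1 k)

/ˢ-correct : ∀ F G {{u : UnitConst G}} → (F /ˢ G) *ˢ G ≈ˢ F
/ˢ-correct F G {{unitConst g}} zero k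
  rewrite coeff-+ (F 0 *ᵖ G 0) [] k = trans (ℤₚ.+-identityʳ _) (*ᵖ-identityʳ (F 0) g k)
/ˢ-correct F G {{u}} (suc n) k = begin
  coeff (a +ᵖ (F′ /ˢ G *ˢ G) n) k             ≡⟨ coeff-+ a _ k ⟩
  coeff a k ℤ.+ coeff ((F′ /ˢ G *ˢ G) n) k    ≡⟨ cong (λ z → coeff a k ℤ.+ z) (/ˢ-correct F′ G {{u}} n k) ⟩
  coeff a k ℤ.+ coeff (F (suc n) -ᵖ a) k      ≡⟨ cong (λ z → coeff a k ℤ.+ z) (coeff-+ (F (suc n)) _ k) ⟩
  coeff a k ℤ.+ (f ℤ.+ coeff (map ℤ.-_ a) k)  ≡⟨ cong (λ z → coeff a k ℤ.+ (f ℤ.+ z)) (coeff-neg a k) ⟩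
  coeff a k ℤ.+ (f ℤ.- coeff a k)             ≡⟨ ℤₚ.+-comm (coeff a k) _ ⟩
  (f ℤ.- coeff a k) ℤ.+ coeff a k             ≡⟨ ℤₚ.+-assoc f _ _ ⟩
  f ℤ.+ (ℤ.- coeff a k ℤ.+ coeff a k)         ≡⟨ cong (λ z → f ℤ.+ z) (ℤₚ.+-inverseˡ (coeff a k)) ⟩
  f ℤ.+ 0ℤ                                    ≡⟨ ℤₚ.+-identityʳ f ⟩
  f                                           ∎
  where
  open ≡-Reasoning
  a  = F 0 *ᵖ G (suc n)
  f  = coeff (F (suc n)) k
  F′ : Series
  F′ j = F (suc j) -ᵖ F 0 *ᵖ G (suc j)

{-# OPTIONS --safe #-}

-- A Catalan word starts with 0, so its second letter is never smaller than its
-- first; at the first descent the preceding step would therefore be weakly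
-- ascending. Hence the avoiding words are the weakly increasing Catalan words:
-- there are 2ⁿ of length n + 1, since each later letter repeats or exceeds by 1
-- the one before, and none has a descent. On the other side, long division by
-- 1 − 2x doubles the remainder at every step once the numerator is exhausted.

module Submission where

open import Defs
open import Data.Integer.Base as ℤ using (0ℤ; +_)
import Data.Integer.Properties as ℤₚ
open import Data.List.Base
  using (List; []; _∷_; _++_; length; map; filter; applyUpTo)
open import Data.List.Membership.Propositional using (_∈_)
open import Data.List.Membership.Propositional.Properties
  using (∈-map⁺; ∈-map⁻; ∈-++⁺ˡ; ∈-++⁺ʳ; ∈-++⁻; ∈-filter⁺; ∈-filter⁻)
open import Data.List.Membership.Propositional.Properties.WithK using (unique∧set⇒bag)
open import Data.List.Properties using (length-map; length-++; ∷-injectiveˡ; ∷-injectiveʳ)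
open import Data.List.Relation.Binary.BagAndSetEquality using (∼bag⇒↭)
open import Data.List.Relation.Binary.Permutation.Propositional.Properties using (↭-length)
open import Data.List.Relation.Unary.All as All using (All; []; _∷_)
open import Data.List.Relation.Unary.Any using (here)
open import Data.List.Relation.Unary.Linked as Linked using (Linked; []; [-]; _∷_)
open import Data.List.Relation.Unary.Unique.Propositional using (Unique; []; _∷_)
import Data.List.Relation.Unary.Unique.Propositional.Properties as Uniqueₚ
import Data.Maybe.Relation.Unary.All as Maybe
open import Data.Nat.Base using (ℕ; zero; suc; _+_; _^_; _≤_; _>_; z≤n)
open import Data.Nat.Properties
  using (_≤?_; _>?_; ≤-refl; n≤1+n; m≤n⇒m<n∨m≡n; ≤-antisym; ≤⇒≯; ≮⇒≥;
         1+n≢n; +-identityʳ)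
open import Data.Product.Base using (_×_; _,_; proj₁; proj₂)
open import Data.Sum.Base using (_⊎_; inj₁; inj₂)
open import Function.Bundles using (mk⇔; Equivalence)
open import Relation.Binary.PropositionalEquality
  using (_≡_; refl; sym; trans; cong; cong₂; module ≡-Reasoning)
open import Relation.Nullary.Decidable using (dec-false)

private
  variable
    a b : ℕ
    w : Word

infix 4 _⋖_
_⋖_ : ℕ → ℕ → Set
a ⋖ b = a ≤ b × b ≤ suc a

⋖⇒≡⊎≡suc : a ⋖ b → b ≡ a ⊎ b ≡ suc a
⋖⇒≡⊎≡suc (a≤b , b≤1+a) with m≤n⇒m<n∨m≡n a≤b
... | inj₁ a<b = inj₂ (≤-antisym b≤1+a a<b)
... | inj₂ a≡b = inj₁ (sym a≡b)

-- The hypothesis `a ≤ b` is the first half of the pattern, so avoidance rules out `b > c`; the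
-- resulting `b ≤ c` is the same hypothesis one letter further on.
avoiding⇒linked : ∀ {w} → Linked (λ a b → b ≤ suc a) (a ∷ b ∷ w) → a ≤ b →
                  Avoids _≤_ _>_ (a ∷ b ∷ w) → Linked _⋖_ (a ∷ b ∷ w)
avoiding⇒linked {w = []}    (r ∷ [-]) a≤b av = (a≤b , r) ∷ [-]
avoiding⇒linked {w = c ∷ w} (r ∷ l)   a≤b av =
  (a≤b , r) ∷ avoiding⇒linked l (≮⇒≥ λ b>c → av (here a≤b b>c)) (λ c → av (there c))

linked⇒avoiding : Linked _⋖_ w → Avoids _≤_ _>_ w
linked⇒avoiding (_ ∷ (b≤c , _) ∷ l) (here _ b>c) = ≤⇒≯ b≤c b>c
linked⇒avoiding l                   (there c)    = linked⇒avoiding (Linked.tail l) c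

catalan∧avoiding⇒linked : ∀ {w} → Catalan (a ∷ w) → Avoids _≤_ _>_ (a ∷ w) →
                          a ≡ 0 × Linked _⋖_ (a ∷ w)
catalan∧avoiding⇒linked {w = []}    (Maybe.just a≡0  , _) _  = a≡0 , [-]
-- The initial letter 0 supplies the weak ascent `z≤n` that starts the induction.
catalan∧avoiding⇒linked {w = b ∷ w} (Maybe.just refl , l) av = refl , avoiding⇒linked l z≤n av

linked⇒catalan : Linked _⋖_ (0 ∷ w) → Catalan (0 ∷ w)
linked⇒catalan l = Maybe.just refl , Linked.map proj₂ l

linked⇒des≡0 : Linked _⋖_ w → des w ≡ 0
linked⇒des≡0 []  = refl
linked⇒des≡0 [-] = refl
linked⇒des≡0 (_∷_ {x = a} {y = b} (a≤b , _) l)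
  rewrite dec-false (a >? b) (≤⇒≯ a≤b) = linked⇒des≡0 l

-- The words that may follow a letter `a` in a `_⋖_`-chain. The letter `a` itself is left out, so
-- the recursion branches exactly on the next letter.
ascents : ℕ → ℕ → List Word
ascents a zero    = [] ∷ []
ascents a (suc n) = map (a ∷_) (ascents a n) ++ map (suc a ∷_) (ascents (suc a) n)

length-ascents : ∀ a n → length (ascents a n) ≡ 2 ^ n
length-ascents a zero    = refl
length-ascents a (suc n) = begin
  length (ascents a (suc n))                        ≡⟨ length-++ (map (a ∷_) (ascents a n)) ⟩
  length (map (a ∷_) (ascents a n)) +
    length (map (suc a ∷_) (ascents (suc a) n))     ≡⟨ cong₂ _+_ (length-map _ (ascents a n)) (length-map _ (ascents (suc a) n)) ⟩
  length (ascents a n) + length (ascents (suc a) n) ≡⟨ cong₂ _+_ (length-ascents a n) (length-ascents (suc a) n) ⟩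
  2 ^ n + 2 ^ n                                     ≡⟨ cong (λ m → 2 ^ n + m) (+-identityʳ (2 ^ n)) ⟨
  2 ^ suc n                                         ∎
  where open ≡-Reasoning

∈-ascents⁺ : ∀ {a w} → Linked _⋖_ (a ∷ w) → w ∈ ascents a (length w)
∈-ascents⁺ [-] = here refl
∈-ascents⁺ {a} (r ∷ l) with ⋖⇒≡⊎≡suc r
... | inj₁ refl = ∈-++⁺ˡ (∈-map⁺ (a ∷_) (∈-ascents⁺ l))
... | inj₂ refl = ∈-++⁺ʳ _ (∈-map⁺ (suc a ∷_) (∈-ascents⁺ l))

∈-ascents⁻ : ∀ a n {w} → w ∈ ascents a n → Linked _⋖_ (a ∷ w) × length w ≡ n
∈-ascents⁻ a zero    (here refl) = [-] , refl
∈-ascents⁻ a (suc n) w∈ with ∈-++⁻ (map (a ∷_) (ascents a n)) w∈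
... | inj₁ w∈ˡ with _ , v∈ , refl ← ∈-map⁻ (a ∷_) w∈ˡ
               with l , eq ← ∈-ascents⁻ a n v∈ = (≤-refl , n≤1+n a) ∷ l , cong suc eq
... | inj₂ w∈ʳ with _ , v∈ , refl ← ∈-map⁻ (suc a ∷_) w∈ʳ
               with l , eq ← ∈-ascents⁻ (suc a) n v∈ = (n≤1+n a , ≤-refl) ∷ l , cong suc eq

ascents-unique : ∀ a n → Unique (ascents a n)
ascents-unique a zero    = [] ∷ []
ascents-unique a (suc n) = Uniqueₚ.++⁺
  (Uniqueₚ.map⁺ ∷-injectiveʳ (ascents-unique a n))
  (Uniqueₚ.map⁺ ∷-injectiveʳ (ascents-unique (suc a) n))
  -- The two halves are disjoint because their words begin with different letters, `a` and `suc a`.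
  λ (w∈ˡ , w∈ʳ) → 1+n≢n (∷-injectiveˡ
    (trans (sym (proj₂ (proj₂ (∈-map⁻ (suc a ∷_) w∈ʳ)))) (proj₂ (proj₂ (∈-map⁻ (a ∷_) w∈ˡ)))))

avoidingWords : ℕ → List Word
avoidingWords n = filter (avoids? _≤?_ _>?_) (catalanWords n)

∈-avoidingWords⁻ : ∀ n {w} → w ∈ avoidingWords (suc n) → w ∈ map (0 ∷_) (ascents 0 n)
∈-avoidingWords⁻ n {w} w∈ = go w (Equivalence.to ∈-catalanWords (proj₁ p)) (proj₂ p)
  where
  p = ∈-filter⁻ (avoids? _≤?_ _>?_) {xs = catalanWords (suc n)} w∈

  go : ∀ w → Catalan w × length w ≡ suc n → Avoids _≤_ _>_ w → w ∈ map (0 ∷_) (ascents 0 n)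
  -- Matching the length with `refl` turns `n` into `length v`, the index at which `∈-ascents⁺`
  -- places `v`.
  go (a ∷ v) (cat , refl) av with refl , l ← catalan∧avoiding⇒linked cat av =
    ∈-map⁺ (0 ∷_) (∈-ascents⁺ l)

∈-avoidingWords⁺ : ∀ n {w} → w ∈ map (0 ∷_) (ascents 0 n) → w ∈ avoidingWords (suc n)
∈-avoidingWords⁺ n w∈
  with _ , v∈ , refl ← ∈-map⁻ (0 ∷_) w∈
  with l , eq ← ∈-ascents⁻ 0 n v∈ =
  ∈-filter⁺ (avoids? _≤?_ _>?_)
    (Equivalence.from ∈-catalanWords (linked⇒catalan l , cong suc eq)) (linked⇒avoiding l)

-- Two duplicate-free lists with the same members are permutations of each other, so the orders of
-- enumeration need not be compared.
length-avoidingWords : ∀ n → length (avoidingWords (suc n)) ≡ 2 ^ n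
length-avoidingWords n = begin
  length (avoidingWords (suc n))        ≡⟨ ↭-length (∼bag⇒↭ (unique∧set⇒bag
    (Uniqueₚ.filter⁺ (avoids? _≤?_ _>?_) (catalanWords-unique (suc n)))
    (Uniqueₚ.map⁺ ∷-injectiveʳ (ascents-unique 0 n))
    (mk⇔ (∈-avoidingWords⁻ n) (∈-avoidingWords⁺ n)))) ⟩
  length (map (0 ∷_) (ascents 0 n))     ≡⟨ length-map (0 ∷_) (ascents 0 n) ⟩
  length (ascents 0 n)                  ≡⟨ length-ascents 0 n ⟩
  2 ^ n                                 ∎
  where open ≡-Reasoning

avoidingWords-des≡0 : ∀ n → All (λ w → des w ≡ 0) (avoidingWords (suc n))
avoidingWords-des≡0 n = All.tabulate λ w∈ →
  let _ , v∈ , w≡0∷v = ∈-map⁻ (0 ∷_) (∈-avoidingWords⁻ n w∈)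
  in trans (cong des w≡0∷v) (linked⇒des≡0 (proj₁ (∈-ascents⁻ 0 n v∈)))

-- Each word contributes `y^ 0`, that is 1. The empty sum is `[]` rather than a list holding one
-- zero, so the equality is `_≈ᵖ_`.
sum-des≡0 : ∀ {ws} → All (λ w → des w ≡ 0) ws →
            sumᵖ (map (λ w → y^ des w) ws) ≈ᵖ + length ws ∷ []
sum-des≡0 [] zero    = refl
sum-des≡0 [] (suc k) = refl
sum-des≡0 {w ∷ ws} (eq ∷ eqs) k
  rewrite eq | coeff-+ 1ᵖ (sumᵖ (map (λ w → y^ des w) ws)) k | sum-des≡0 eqs k
  with k
... | zero  = refl
... | suc _ = refl

*ᵖ-constʳ : ∀ p {q c} → q ≈ᵖ c ∷ [] → ∀ k → coeff (p *ᵖ q) k ≡ coeff p k ℤ.* c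
*ᵖ-constʳ []      {c = c} q≈c k = sym (ℤₚ.*-zeroˡ c)
*ᵖ-constʳ (a ∷ p) {q} q≈c zero
  rewrite coeff-+ (a ·ᵖ q) (0ℤ ∷ p *ᵖ q) 0 | coeff-· a q 0 | q≈c 0 = ℤₚ.+-identityʳ _
*ᵖ-constʳ (a ∷ p) {q} q≈c (suc k)
  rewrite coeff-+ (a ·ᵖ q) (0ℤ ∷ p *ᵖ q) (suc k) | coeff-· a q (suc k) | q≈c (suc k)
        | ℤₚ.*-zeroʳ a = trans (ℤₚ.+-identityˡ _) (*ᵖ-constʳ p q≈c k)

-- The polynomial on the left has the shape of a remainder coefficient in `_/ˢ_`. The coefficients
-- of `1-2x` are constant in y, so division acts on each power of y separately.
coeff-remainder : ∀ f p {q c} → q ≈ᵖ c ∷ [] → ∀ k →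
                  coeff (f -ᵖ p *ᵖ q) k ≡ coeff f k ℤ.- coeff p k ℤ.* c
coeff-remainder f p {q} {c} q≈c k
  rewrite coeff-+ f (map ℤ.-_ (p *ᵖ q)) k | coeff-neg (p *ᵖ q) k | *ᵖ-constʳ p {q} {c} q≈c k = refl

1-2x : Series
1-2x = 1ˢ -ˢ 2ˢ *ˢ x

1-2x-linear : 1-2x 1 ≈ᵖ ℤ.- (+ 2) ∷ []
1-2x-linear zero          = refl
1-2x-linear (suc zero)    = refl
1-2x-linear (suc (suc _)) = refl

sum-zeros : ∀ n → sumᵖ (applyUpTo (λ _ → 0ᵖ) n) ≡ 0ᵖ
sum-zeros zero    = refl
sum-zeros (suc n) = sum-zeros n

-- In the convolution `2ˢ *ˢ x` the first term meets a zero coefficient of `x`, and all later terms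
-- vanish because `2ˢ` is constant; `sum-zeros` collapses these.
1-2x-higher : ∀ n → 1-2x (suc (suc n)) ≈ᵖ 0ℤ ∷ []
1-2x-higher n k rewrite sum-zeros n with k
... | zero  = refl
... | suc _ = refl

-- One division step turns the constant series c into the constant series 2c, so the induction on
-- `n` lets `F` and `c` vary.
const/1-2x : ∀ F {c} → F 0 ≈ᵖ c ∷ [] → (∀ k → F (suc k) ≈ᵖ 0ᵖ) →
             ∀ n → (F /ˢ 1-2x) n ≈ᵖ c ℤ.* + (2 ^ n) ∷ []
const/1-2x F {c} F₀ F₊ zero    k = trans (F₀ k) (cong (λ z → coeff (z ∷ []) k) (sym (ℤₚ.*-identityʳ c)))
const/1-2x F {c} F₀ F₊ (suc n) k =
  trans (const/1-2x F′ {c ℤ.* + 2} F′₀ F′₊ n k) (cong (λ z → coeff (z ∷ []) k) eq)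
  where
  F′ : Series
  F′ j = F (suc j) -ᵖ F 0 *ᵖ 1-2x (suc j)

  F′₀ : F′ 0 ≈ᵖ c ℤ.* + 2 ∷ []
  F′₀ k rewrite coeff-remainder (F 1) (F 0) {1-2x 1} {ℤ.- (+ 2)} 1-2x-linear k | F₊ 0 k | F₀ k with k
  ... | zero  = trans (ℤₚ.+-identityˡ _) (ℤₚ.neg-distribʳ-* c (ℤ.- (+ 2)))
  ... | suc _ = refl

  F′₊ : ∀ j → F′ (suc j) ≈ᵖ 0ᵖ
  F′₊ j k rewrite coeff-remainder (F (suc (suc j))) (F 0) {1-2x (suc (suc j))} {0ℤ} (1-2x-higher j) k | F₊ (suc j) k
                | ℤₚ.*-zeroʳ (coeff (F 0) k) = refl

  eq : c ℤ.* + 2 ℤ.* + (2 ^ n) ≡ c ℤ.* + (2 ^ suc n)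
  eq = trans (ℤₚ.*-assoc c (+ 2) (+ (2 ^ n))) (cong (c ℤ.*_) (sym (ℤₚ.pos-* 2 (2 ^ n))))

-- After one division step the remainder is the constant series 1, since -1 - 1 * (-2) = 1 and no
-- higher terms remain. That step uses up one power of x, whence the exponent `n` at index `suc n`.
1-x/1-2x : ∀ n → ((1ˢ -ˢ x) /ˢ 1-2x) (suc n) ≈ᵖ + (2 ^ n) ∷ []
1-x/1-2x n k = trans (const/1-2x F′ {+ 1} F′₀ F′₊ n k)
  (cong (λ z → coeff (z ∷ []) k) (ℤₚ.*-identityˡ (+ (2 ^ n))))
  where
  F′ : Series
  F′ j = (1ˢ -ˢ x) (suc j) -ᵖ (1ˢ -ˢ x) 0 *ᵖ 1-2x (suc j)

  F′₀ : F′ 0 ≈ᵖ + 1 ∷ []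
  F′₀ zero          = refl
  F′₀ (suc zero)    = refl
  F′₀ (suc (suc _)) = refl

  F′₊ : ∀ j → F′ (suc j) ≈ᵖ 0ᵖ
  F′₊ j k rewrite coeff-remainder 0ᵖ 1ᵖ {1-2x (suc (suc j))} {0ℤ} (1-2x-higher j) k | ℤₚ.*-zeroʳ (coeff 1ᵖ k) = refl

theorem3p25 : C _≤?_ _>?_ ≈ˢ (1ˢ -ˢ x) /ˢ (1ˢ -ˢ 2ˢ *ˢ x)
-- The powers of 2 begin at length 1; at length 0 both sides compute to 1.
theorem3p25 zero    k = refl
theorem3p25 (suc n) k = begin
  coeff (C _≤?_ _>?_ (suc n)) k                   ≡⟨ sum-des≡0 (avoidingWords-des≡0 n) k ⟩
  coeff (+ length (avoidingWords (suc n)) ∷ []) k ≡⟨ cong (λ m → coeff (+ m ∷ []) k) (length-avoidingWords n) ⟩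
  coeff (+ (2 ^ n) ∷ []) k                        ≡⟨ 1-x/1-2x n k ⟨
  coeff (((1ˢ -ˢ x) /ˢ (1ˢ -ˢ 2ˢ *ˢ x)) (suc n)) k ∎
  where open ≡-Reasoning
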